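{- Let $n\ge 3$, $1\le t<n$, and let $c_1,c_2,\ldots,c_t\in[n]$ be distinct integers such that the sequence $(c_1,\ldots,c_t)$ avoids both patterns $123$ and $213$. If there exist $\alpha\in[n]\setminus\{c_1,\ldots,c_t\}$ and $1\le i<j\le t$ with $c_i<\alpha$ and $c_j<\alpha$, then $|S_{n,(c_1,\ldots,c_t)}(123,213)|=0$; otherwise, $$|S_{n,(c_1,\ldots,c_t)}(123,213)|=2^{\max\{0,\min\{c_1,\ldots,c_t\}-2\}}.$$
   Context: $[n]=\{1,\ldots,n\}$ and $S_n$ is the set of permutations of $[n]$ written as sequences $(\tau(1),\ldots,\tau(n))$. A sequence of distinct integers $\tau=(\tau(1),\ldots,\tau(m))$ contains $\sigma\in S_k$ as a pattern if there are indices $1\le i_1<\cdots<i_k\le m$ such that for all $1\le a<b\le k$, $\tau(i_a)<\tau(i_b)$ if and only if $\sigma(a)<\sigma(b)$; otherwise $\tau$ avoids $\sigma$. $S_{n,(c_1,\ldots,c_t)}(\sigma_1,\ldots,\sigma_m)$ is the set of $\tau\in S_n$ with $(\tau(1),\ldots,\tau(t))=(c_1,\ldots,c_t)$ that avoid all of $\sigma_1,\ldots,\sigma_m$. -}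

module Defs where

open import Data.Fin using (Fin; toℕ; inject≤; _<_; zero; suc)
open import Data.Fin.Permutation using (Permutation′; _⟨$⟩ʳ_; id; transpose)
open import Data.List using (List; []; _∷_; tabulate)
open import Data.List.Extrema.Nat using (min)
open import Data.List.Relation.Unary.All using (All)
import Data.Nat as ℕ
open ℕ using (ℕ)
open import Data.Product using (Σ; ∃; ∃-syntax; _×_; _,_; proj₁)
open import Data.Vec.Functional using (Vector)
open import Function using (Inverse; _⇔_)
open import Level using (Level; 0ℓ; _⊔_)
open import Relation.Binary using (Setoid)
import Relation.Binary.Construct.On as On
open import Relation.Binary.PropositionalEquality using (_≡_; setoid; _→-setoid_)
open import Relation.Nullary using (¬_)

-- [n] is Fin n and Sₙ is Permutation′ n.  As indices and as values the elements
-- of Fin n are shifted by one: i stands for the integer suc (toℕ i).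

Contains : ∀ {n m k} → Vector (Fin n) m → Permutation′ k → Set
Contains {m = m} {k} τ σ =
  Σ (Vector (Fin m) k) λ i →
    (∀ a b → a < b → i a < i b) ×
    (∀ a b → a < b → (τ (i a) < τ (i b)) ⇔ (σ ⟨$⟩ʳ a < σ ⟨$⟩ʳ b))

Avoids : ∀ {n m k} → Vector (Fin n) m → Permutation′ k → Set
Avoids τ σ = ¬ Contains τ σ

π123 π213 : Permutation′ 3
π123 = id
π213 = transpose zero (suc zero)

IsIn-S : ∀ {n t} → .(t ℕ.≤ n) → Vector (Fin n) t → List (∃ Permutation′) →
         Permutation′ n → Set
IsIn-S t≤n c σs τ =
  (∀ i → τ ⟨$⟩ʳ inject≤ i t≤n ≡ c i) ×
  All (λ (_ , σ) → Avoids (τ ⟨$⟩ʳ_) σ) σs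

-- Elements are identified when their underlying sequences agree pointwise, so
-- that neither the inverse maps nor the avoidance proofs affect the cardinality.
S : ∀ {n t} → .(t ℕ.≤ n) → Vector (Fin n) t → List (∃ Permutation′) → Setoid 0ℓ 0ℓ
S {n} t≤n c σs =
  On.setoid {B = Σ (Permutation′ n) (IsIn-S t≤n c σs)}
            (Fin n →-setoid Fin n) (λ (τ , _) → τ ⟨$⟩ʳ_)

HasCardinality : ∀ {a ℓ : Level} → Setoid a ℓ → ℕ → Set (a ⊔ ℓ)
HasCardinality A k = Inverse A (setoid (Fin k))

-- The first argument of min is the value for the empty list; every entry is at
-- most n, so it does not affect the minimum of a nonempty sequence.
minEntry : ∀ {n t} → Vector (Fin n) t → ℕ
minEntry {n} c = min n (tabulate λ i → ℕ.suc (toℕ (c i)))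

TwoEntriesBelowMissing : ∀ {n t} → Vector (Fin n) t → Set
TwoEntriesBelowMissing c =
  ∃[ α ] (∀ i → ¬ α ≡ c i) × ∃[ i ] ∃[ j ] i < j × c i < α × c j < α

{-# OPTIONS --safe #-}
-- Avoiding 123 and 213 means that every entry has at most one smaller entry
-- before it.  The last entry of such a permutation is therefore one of the two
-- smallest values, and deleting it (and closing the gap in the values) leaves a
-- permutation of the same kind; conversely, either of the two smallest values
-- may be appended freely.  Delete last entries until only the prefix c is left.
-- While min c exceeds the two smallest values both choices are available and
-- min c drops by one.  Afterwards exactly one of the two smallest values is an
-- entry of c (if both were, they would lie below any value missing from c), so
-- the choice is forced.
module Submission where

open import Defs
open import Data.Fin using (Fin; zero; suc; toℕ; fromℕ; fromℕ<; inject≤; punchIn; punchOut; _↑ˡ_)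
  renaming (_<_ to _<ᶠ_; _≤_ to _≤ᶠ_)
open import Data.Fin.Permutation
  using (Permutation′; _⟨$⟩ʳ_; _⟨$⟩ˡ_; _≈_; insert; remove; permutation;
         insert-punchIn; insert-remove; inverseˡ; inverseʳ)
open import Data.Fin.Properties
  using (_≟_; any?; ¬Fin0; ¬∀⟶∃¬; ≤fromℕ; ≤∧≢⇒<; <-cmp; <-irrefl; toℕ<n; toℕ-injective;
         toℕ-inject≤; toℕ-fromℕ<; inject≤-injective; inject≤-refl; injective⇒≤; punchIn-injective;
         punchInᵢ≢i; punchIn-mono-≤; punchIn-cancel-≤; punchIn-punchOut; punchOut-injective;
         ↑ˡ-injective; *↔×)
open import Data.List using ([]; _∷_; tabulate)
import Data.List.Extrema.Nat as Extrema
open import Data.List.Membership.Propositional.Properties using (∈-tabulate⁻)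
open import Data.List.Relation.Unary.All using ([]; _∷_)
open import Data.List.Relation.Unary.All.Properties using (tabulate⁻)
open import Data.Nat
  using (ℕ; suc; _*_; _≤_; _<_; _∸_; _^_; _⊔_; z≤n; s≤s; s≤s⁻¹; _≤′_; ≤′-step; ≤′-reflexive)
open import Data.Nat.Properties
  using (<⇒≤; <⇒≱; ≰⇒>; ≤-refl; ≤-trans; ≤-antisym; ≮⇒≥; n≤0⇒n≡0; ≤′⇒≤; ≤⇒≤′; *-identityˡ)
open import Data.Product using (Σ; ∃-syntax; _×_; _,_; proj₁; proj₂)
open import Data.Product.Function.NonDependent.Setoid using (_×-inverse_)
open import Data.Product.Relation.Binary.Pointwise.NonDependent using (_×ₛ_; Pointwise-≡↔≡)
open import Data.Sum using (_⊎_; inj₁; inj₂)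
open import Data.Vec.Functional using (Vector)
open import Function using (Injective; Inverse; Equivalence; _⇔_; mk⇔; _∘_; id)
open import Function.Construct.Composition using (inverse)
open import Function.Construct.Identity using () renaming (inverse to idⁱ)
open import Function.Construct.Symmetry using () renaming (inverse to symⁱ)
open import Level using (0ℓ)
open import Relation.Binary using (Setoid; tri<; tri≈; tri>)
import Relation.Binary.Construct.On as On
open import Relation.Binary.PropositionalEquality
  using (_≡_; _≢_; refl; sym; trans; cong; subst; subst₂; setoid; _→-setoid_)
open import Relation.Nullary using (¬_; yes; no; contradiction)

private
  variable
    k m n t : ℕ

-- The patterns 123 and 213 differ only in the order of their two smaller entries. Concluding
-- `i ≡ j` for an unordered pair merges both into one condition.
Sparse : Vector (Fin n) m → Set
Sparse τ = ∀ {i j k} → i <ᶠ k → j <ᶠ k → τ i <ᶠ τ k → τ j <ᶠ τ k → i ≡ j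

-- Order and pigeonhole facts on finite sets.

punchIn-mono-< : ∀ d {x y : Fin n} → x <ᶠ y → punchIn d x <ᶠ punchIn d y
punchIn-mono-< d {x} {y} x<y = ≰⇒> (<⇒≱ x<y ∘ punchIn-cancel-≤ d y x)

punchIn-cancel-< : ∀ d {x y : Fin n} → punchIn d x <ᶠ punchIn d y → x <ᶠ y
punchIn-cancel-< d {x} {y} lt = ≰⇒> (<⇒≱ lt ∘ punchIn-mono-≤ d y x)

≡⊎punchIn : ∀ (d i : Fin (suc n)) → d ≡ i ⊎ ∃[ j ] punchIn d j ≡ i
≡⊎punchIn d i with d ≟ i
... | yes d≡i = inj₁ d≡i
... | no  d≢i = inj₂ (punchOut d≢i , punchIn-punchOut d≢i)

-- Skipping the last position fixes all earlier ones, so prefix positions take the form to which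
-- `insert-punchIn` applies.
inject≤-punchIn : .(t≤1+n : t ≤ suc n) .(t≤n : t ≤ n) (i : Fin t) →
                  inject≤ i t≤1+n ≡ punchIn (fromℕ n) (inject≤ i t≤n)
inject≤-punchIn {n = 0}     _ t≤n i       = contradiction (inject≤ i t≤n) ¬Fin0
inject≤-punchIn {n = suc n} _ _   zero    = refl
inject≤-punchIn {n = suc n} p q   (suc i) = cong suc (inject≤-punchIn (s≤s⁻¹ p) (s≤s⁻¹ q) i)

⟨$⟩ʳ-injective : (π : Permutation′ n) → Injective _≡_ _≡_ (π ⟨$⟩ʳ_)
⟨$⟩ʳ-injective π eq = trans (sym (inverseˡ π)) (trans (cong (π ⟨$⟩ˡ_) eq) (inverseˡ π))

missing : t < n → (c : Vector (Fin n) t) → ∃[ α ] ∀ i → α ≢ c i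
missing {n = n} t<n c =
  let α , α∉c = ¬∀⟶∃¬ n (λ α → ∃[ i ] α ≡ c i) (λ α → any? λ i → α ≟ c i)
                  λ surj → <⇒≱ t<n (injective⇒≤ {f = proj₁ ∘ surj}
                    λ {x} {y} eq → trans (proj₂ (surj x)) (trans (cong c eq) (sym (proj₂ (surj y)))))
  in α , λ i α≡ci → α∉c (i , α≡ci)

injective⇒surjective : (f : Fin n → Fin n) → Injective _≡_ _≡_ f → ∀ y → ∃[ x ] f x ≡ y
injective⇒surjective {n = suc n} f inj y with any? (λ x → f x ≟ y)
... | yes hit = hit
-- A missed value `y` could be punched out, injecting `Fin (suc n)` into `Fin n`.
... | no  y∉f = contradiction (injective⇒≤ {f = λ x → punchOut (y≢f x)}
                  (λ {x} {z} → inj ∘ punchOut-injective (y≢f x) (y≢f z))) (<⇒≱ (s≤s ≤-refl))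
  where
  y≢f : ∀ x → y ≢ f x
  y≢f x y≡fx = y∉f (x , sym y≡fx)

-- Sparseness versus avoidance of 123 and 213.

Sparse⇒avoids : {τ : Vector (Fin n) m} → Sparse τ → (σ : Permutation′ 3) →
                σ ⟨$⟩ʳ zero <ᶠ σ ⟨$⟩ʳ suc (suc zero) →
                σ ⟨$⟩ʳ suc zero <ᶠ σ ⟨$⟩ʳ suc (suc zero) → Avoids τ σ
Sparse⇒avoids sp σ σ₀<σ₂ σ₁<σ₂ (i , i-mono , iso) =
  -- Both smaller entries of an occurrence precede its largest, so sparseness identifies two
  -- positions that `i-mono` separates.
  <-irrefl (sp (i-mono _ _ 0<2) (i-mono _ _ 1<2)
               (Equivalence.from (iso _ _ 0<2) σ₀<σ₂) (Equivalence.from (iso _ _ 1<2) σ₁<σ₂))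
           (i-mono zero (suc zero) (s≤s z≤n))
  where
  0<2 : zero {2} <ᶠ suc {2} (suc zero)
  0<2 = s≤s z≤n
  1<2 : suc {2} zero <ᶠ suc {2} (suc zero)
  1<2 = s≤s (s≤s z≤n)

module _ {τ : Vector (Fin n) m} {i j k} (i<j : i <ᶠ j) (j<k : j <ᶠ k)
         (τi<τk : τ i <ᶠ τ k) (τj<τk : τ j <ᶠ τ k) where

  private
    ι : Vector (Fin m) 3
    ι zero             = i
    ι (suc zero)       = j
    ι (suc (suc zero)) = k

    ι-mono : ∀ a b → a <ᶠ b → ι a <ᶠ ι b
    ι-mono zero       (suc zero)       _ = i<j
    ι-mono zero       (suc (suc zero)) _ = ≤-trans i<j (<⇒≤ j<k)
    ι-mono (suc zero) (suc (suc zero)) _ = j<k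
    ι-mono (suc zero) (suc zero) (s≤s ())
    ι-mono (suc (suc zero)) (suc zero) (s≤s ())
    ι-mono (suc (suc zero)) (suc (suc zero)) (s≤s (s≤s ()))

  contains-123 : τ i <ᶠ τ j → Contains τ π123
  contains-123 τi<τj = ι , ι-mono , iso
    where
    iso : ∀ a b → a <ᶠ b → (τ (ι a) <ᶠ τ (ι b)) ⇔ (π123 ⟨$⟩ʳ a <ᶠ π123 ⟨$⟩ʳ b)
    iso zero       (suc zero)       a<b = mk⇔ (λ _ → a<b) (λ _ → τi<τj)
    iso zero       (suc (suc zero)) a<b = mk⇔ (λ _ → a<b) (λ _ → τi<τk)
    iso (suc zero) (suc (suc zero)) a<b = mk⇔ (λ _ → a<b) (λ _ → τj<τk)
    iso (suc zero) (suc zero) (s≤s ())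
    iso (suc (suc zero)) (suc zero) (s≤s ())
    iso (suc (suc zero)) (suc (suc zero)) (s≤s (s≤s ()))

  contains-213 : τ j <ᶠ τ i → Contains τ π213
  contains-213 τj<τi = ι , ι-mono , iso
    where
    iso : ∀ a b → a <ᶠ b → (τ (ι a) <ᶠ τ (ι b)) ⇔ (π213 ⟨$⟩ʳ a <ᶠ π213 ⟨$⟩ʳ b)
    -- Both sides are false: 213 begins with a descent.
    iso zero       (suc zero)       _ = mk⇔ (λ lt → contradiction lt (<⇒≱ (s≤s (<⇒≤ τj<τi)))) λ ()
    iso zero       (suc (suc zero)) _ = mk⇔ (λ _ → s≤s (s≤s z≤n)) (λ _ → τi<τk)
    iso (suc zero) (suc (suc zero)) _ = mk⇔ (λ _ → s≤s z≤n) (λ _ → τj<τk)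
    iso (suc zero) (suc zero) (s≤s ())
    iso (suc (suc zero)) (suc zero) (s≤s ())
    iso (suc (suc zero)) (suc (suc zero)) (s≤s (s≤s ()))

module _ {τ : Vector (Fin n) m} (τ-injective : Injective _≡_ _≡_ τ)
         (avoids-123 : Avoids τ π123) (avoids-213 : Avoids τ π213) where

  private
    ¬ordered : ∀ {i j k} → i <ᶠ j → j <ᶠ k → τ i <ᶠ τ k → ¬ τ j <ᶠ τ k
    ¬ordered {i} {j} i<j j<k τi<τk τj<τk with <-cmp (τ i) (τ j)
    ... | tri< τi<τj _ _ = avoids-123 (contains-123 i<j j<k τi<τk τj<τk τi<τj)
    ... | tri≈ _ τi≡τj _ = <-irrefl (τ-injective τi≡τj) i<j
    ... | tri> _ _ τj<τi = avoids-213 (contains-213 i<j j<k τi<τk τj<τk τj<τi)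

  -- Two distinct earlier positions with smaller entries would complete a 123 or a 213, depending on
  -- which of the two entries is larger; injectivity excludes a tie.
  avoids⇒Sparse : Sparse τ
  avoids⇒Sparse {i} {j} i<k j<k τi<τk τj<τk with <-cmp i j
  ... | tri< i<j _ _ = contradiction τj<τk (¬ordered i<j j<k τi<τk)
  ... | tri≈ _ i≡j _ = i≡j
  ... | tri> _ _ j<i = contradiction τi<τk (¬ordered j<i i<k τj<τk)

-- `S` is definitionally an instance, so its predicate can be exchanged for an equivalent one.
Permutations : (Permutation′ n → Set) → Setoid 0ℓ 0ℓ
Permutations {n} P =
  On.setoid {B = Σ (Permutation′ n) P} (Fin n →-setoid Fin n) (λ (τ , _) → τ ⟨$⟩ʳ_)

Permutations-cong : {P Q : Permutation′ n → Set} → (∀ τ → P τ ⇔ Q τ) →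
                    Inverse (Permutations P) (Permutations Q)
Permutations-cong P⇔Q = record
  { to        = λ (τ , p) → τ , Equivalence.to (P⇔Q τ) p
  ; from      = λ (τ , q) → τ , Equivalence.from (P⇔Q τ) q
  ; to-cong   = λ eq → eq
  ; from-cong = λ eq → eq
  ; inverse   = (λ eq → eq) , (λ eq → eq)
  }

-- Appending and deleting a last entry.

append : Fin (suc n) → Permutation′ n → Permutation′ (suc n)
append = insert (fromℕ _)

append-fromℕ : ∀ d (π : Permutation′ n) → append d π ⟨$⟩ʳ fromℕ n ≡ d
append-fromℕ {n} d π with fromℕ n ≟ fromℕ n
... | yes _ = refl
... | no ¬p = contradiction refl ¬p

append-punchIn : ∀ d (π : Permutation′ n) i →
                 append d π ⟨$⟩ʳ punchIn (fromℕ n) i ≡ punchIn d (π ⟨$⟩ʳ i)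
append-punchIn = insert-punchIn (fromℕ _)

append-cong : ∀ d {π ρ : Permutation′ n} → π ≈ ρ → append d π ≈ append d ρ
append-cong d {π} {ρ} π≈ρ i with ≡⊎punchIn (fromℕ _) i
... | inj₁ refl = trans (append-fromℕ d π) (sym (append-fromℕ d ρ))
... | inj₂ (j , refl) = trans (append-punchIn d π j)
                          (trans (cong (punchIn d) (π≈ρ j)) (sym (append-punchIn d ρ j)))

append-injectiveˡ : ∀ {d e} {π ρ : Permutation′ n} → append d π ≈ append e ρ → d ≡ e
append-injectiveˡ {d = d} {e} {π} {ρ} eq =
  trans (sym (append-fromℕ d π)) (trans (eq _) (append-fromℕ e ρ))

append-injectiveʳ : ∀ {d e} {π ρ : Permutation′ n} → append d π ≈ append e ρ → π ≈ ρ
append-injectiveʳ {d = d} {e} {π} {ρ} eq i with append-injectiveˡ {d = d} {e} {π} {ρ} eq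
... | refl = punchIn-injective d _ _
               (trans (sym (append-punchIn d π i)) (trans (eq _) (append-punchIn d ρ i)))

module _ {P : Permutation′ (suc n) → Set} {Q : Permutation′ n → Set} (e : Fin k → Fin (suc n))
         (e-injective : Injective _≡_ _≡_ e)
         (P-resp : ∀ {τ ρ} → τ ≈ ρ → P τ → P ρ)
         (P⇒last : ∀ τ → P τ → ∃[ x ] τ ⟨$⟩ʳ fromℕ n ≡ e x)
         (append⇔ : ∀ x π → P (append (e x) π) ⇔ Q π) where

  private
    init : Permutation′ (suc n) → Permutation′ n
    init = remove (fromℕ n)

    append-init : ∀ τ p → append (e (proj₁ (P⇒last τ p))) (init τ) ≈ τ
    append-init τ p =
      subst (λ d → append d (init τ) ≈ τ) (proj₂ (P⇒last τ p)) (insert-remove (fromℕ n) τ)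

    append∘e-injective : ∀ {x y π ρ} → append (e x) π ≈ append (e y) ρ → x ≡ y × π ≈ ρ
    append∘e-injective {x} {y} {π} {ρ} eq =
      e-injective (append-injectiveˡ {π = π} {ρ} eq) ,
      append-injectiveʳ {d = e x} {e y} {π} {ρ} eq

  -- The map `e` lists the admissible last entries. The remainder satisfies the same `Q` whichever
  -- of them is deleted, which makes the set a product.
  decomposeLast : Inverse (Permutations P) (setoid (Fin k) ×ₛ Permutations Q)
  decomposeLast = record
    { to = λ (τ , p) → proj₁ (P⇒last τ p) , init τ ,
        -- Reassembling `τ` recovers it only pointwise, hence `P-resp`.
        Equivalence.to (append⇔ _ _) (P-resp (sym ∘ append-init τ p) p)
    ; from = λ (x , π , q) → append (e x) π , Equivalence.from (append⇔ x π) q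
    ; to-cong = λ { {τ , p} {ρ , r} τ≈ρ → append∘e-injective {π = init τ} {init ρ}
        λ i → trans (append-init τ p i) (trans (τ≈ρ i) (sym (append-init ρ r i))) }
    ; from-cong = λ { {x , π , _} {_ , ρ , _} (refl , π≈ρ) → append-cong (e x) {π} {ρ} π≈ρ }
    ; inverse =
        (λ { {_ , ρ , _} {τ , p} τ≈ → append∘e-injective {π = init τ} {ρ}
           λ i → trans (append-init τ p i) (τ≈ i) })
      , (λ { {τ , p} {x , π , _} (refl , π≈) i →
           trans (append-cong (e x) {π} {init τ} π≈ i) (append-init τ p i) })
    }

  decomposeLast-cardinality : HasCardinality (Permutations Q) m →
                              HasCardinality (Permutations P) (k * m)
  decomposeLast-cardinality h =
    inverse decomposeLast (inverse (idⁱ _ ×-inverse h) (inverse Pointwise-≡↔≡ (symⁱ *↔×)))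

-- Permutations extending a prefix.

Extends : .(t ≤ n) → Vector (Fin n) t → Permutation′ n → Set
Extends t≤n c τ = (∀ i → τ ⟨$⟩ʳ inject≤ i t≤n ≡ c i) × Sparse (τ ⟨$⟩ʳ_)

Sparse-resp : {τ ρ : Vector (Fin n) m} → (∀ i → τ i ≡ ρ i) → Sparse τ → Sparse ρ
Sparse-resp eq sp i<k j<k ρi<ρk ρj<ρk =
  sp i<k j<k (subst₂ _<ᶠ_ (sym (eq _)) (sym (eq _)) ρi<ρk)
             (subst₂ _<ᶠ_ (sym (eq _)) (sym (eq _)) ρj<ρk)

Sparse-punchIn : ∀ d {τ : Vector (Fin (suc n)) m} {ρ} →
                 (∀ i → τ i ≡ punchIn d (ρ i)) → Sparse τ → Sparse ρ
Sparse-punchIn d eq sp i<k j<k ρi<ρk ρj<ρk =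
  Sparse-resp eq sp i<k j<k (punchIn-mono-< d ρi<ρk) (punchIn-mono-< d ρj<ρk)

-- The shift of values by `punchIn d` keeps the order of the old entries. A new violation would need
-- two values below `d`, but `d ≤ 1` leaves at most the value 0.
Sparse-append : ∀ d (π : Permutation′ n) → toℕ d ≤ 1 →
                Sparse (append d π ⟨$⟩ʳ_) ⇔ Sparse (π ⟨$⟩ʳ_)
Sparse-append {n} d π d≤1 = mk⇔ restrict extend
  where
  last = fromℕ n

  restrict : Sparse (append d π ⟨$⟩ʳ_) → Sparse (π ⟨$⟩ʳ_)
  restrict sp = Sparse-punchIn d (append-punchIn d π)
    λ i<k j<k τi<τk τj<τk → punchIn-injective last _ _
      (sp (punchIn-mono-< last i<k) (punchIn-mono-< last j<k) τi<τk τj<τk)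

  zero-below : ∀ {x y : Fin (suc n)} → x <ᶠ d → y <ᶠ d → x ≡ y
  zero-below {zero} {zero} _ _ = refl
  zero-below {suc _} x<d _ = contradiction (≤-trans x<d d≤1) (<⇒≱ (s≤s (s≤s z≤n)))
  zero-below {zero} {suc _} _ y<d = contradiction (≤-trans y<d d≤1) (<⇒≱ (s≤s (s≤s z≤n)))

  extend : Sparse (π ⟨$⟩ʳ_) → Sparse (append d π ⟨$⟩ʳ_)
  extend sp {i} {j} {k} i<k j<k τi<τk τj<τk with ≡⊎punchIn last k
  ... | inj₁ refl = ⟨$⟩ʳ-injective (append d π)
          (zero-below (subst (append d π ⟨$⟩ʳ i <ᶠ_) (append-fromℕ d π) τi<τk)
                      (subst (append d π ⟨$⟩ʳ j <ᶠ_) (append-fromℕ d π) τj<τk))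
  ... | inj₂ (k′ , refl) with ≡⊎punchIn last i | ≡⊎punchIn last j
  ... | inj₁ refl | _ = contradiction (≤fromℕ (punchIn last k′)) (<⇒≱ i<k)
  ... | inj₂ _ | inj₁ refl = contradiction (≤fromℕ (punchIn last k′)) (<⇒≱ j<k)
  ... | inj₂ (i′ , refl) | inj₂ (j′ , refl) = cong (punchIn last)
          (sp (punchIn-cancel-< last i<k) (punchIn-cancel-< last j<k)
              (below i′ τi<τk) (below j′ τj<τk))
    where
    below : ∀ i → append d π ⟨$⟩ʳ punchIn last i <ᶠ append d π ⟨$⟩ʳ punchIn last k′ →
            π ⟨$⟩ʳ i <ᶠ π ⟨$⟩ʳ k′
    below i lt = punchIn-cancel-< d
      (subst₂ _<ᶠ_ (append-punchIn d π i) (append-punchIn d π k′) lt)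

Extends-resp : .(t≤n : t ≤ n) (c : Vector (Fin n) t) {τ ρ : Permutation′ n} →
               τ ≈ ρ → Extends t≤n c τ → Extends t≤n c ρ
Extends-resp t≤n c {τ} {ρ} τ≈ρ (prefix , sp) =
  (λ i → trans (sym (τ≈ρ _)) (prefix i)) , Sparse-resp {τ = τ ⟨$⟩ʳ_} {ρ ⟨$⟩ʳ_} τ≈ρ sp

-- The reduced prefix `c′` is a parameter, not a `punchOut` at `d`, so that one `c′` can serve two
-- different last entries.
Extends-append : .(t≤1+n : t ≤ suc n) .(t≤n : t ≤ n)
                 {c : Vector (Fin (suc n)) t} {c′ : Vector (Fin n) t} →
                 ∀ d → toℕ d ≤ 1 → (∀ i → c i ≡ punchIn d (c′ i)) →
                 ∀ π → Extends t≤1+n c (append d π) ⇔ Extends t≤n c′ π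
Extends-append {n = n} t≤1+n t≤n {c} {c′} d d≤1 c≡ π = mk⇔
  (λ (prefix , sp) →
    (λ i → punchIn-injective d _ _ (trans (sym (value i)) (trans (prefix i) (c≡ i)))) ,
    Equivalence.to (Sparse-append d π d≤1) sp)
  (λ (prefix , sp) →
    (λ i → trans (value i) (trans (cong (punchIn d) (prefix i)) (sym (c≡ i)))) ,
    Equivalence.from (Sparse-append d π d≤1) sp)
  where
  value : ∀ i → append d π ⟨$⟩ʳ inject≤ i t≤1+n ≡ punchIn d (π ⟨$⟩ʳ inject≤ i t≤n)
  value i = trans (cong (append d π ⟨$⟩ʳ_) (inject≤-punchIn t≤1+n t≤n i)) (append-punchIn d π _)

last∉prefix : .(t≤1+n : t ≤ suc n) .(t≤n : t ≤ n) (c : Vector (Fin (suc n)) t) →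
              ∀ {τ} → Extends t≤1+n c τ → ∀ i → τ ⟨$⟩ʳ fromℕ n ≢ c i
last∉prefix t≤1+n t≤n c {τ} (prefix , _) i last≡ci = punchInᵢ≢i _ _
  (trans (sym (inject≤-punchIn t≤1+n t≤n i))
         (⟨$⟩ʳ-injective τ (trans (prefix i) (sym last≡ci))))

-- Otherwise the values 0 and 1 both occur earlier and below the last entry, so sparseness puts them
-- at the same position.
last≤1 : (τ : Permutation′ (suc n)) → Sparse (τ ⟨$⟩ʳ_) → toℕ (τ ⟨$⟩ʳ fromℕ n) ≤ 1
last≤1 {n} τ sp with τ ⟨$⟩ʳ fromℕ n in eq
... | zero = z≤n
... | suc zero = s≤s z≤n
... | suc (suc v) = contradiction
        (trans (sym (inverseʳ τ)) (trans (cong (τ ⟨$⟩ʳ_)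
          (sp (before {zero} (s≤s z≤n)) (before {suc zero} (s≤s (s≤s z≤n)))
              (smaller (s≤s z≤n)) (smaller (s≤s (s≤s z≤n))))) (inverseʳ τ)))
        λ ()
  where

  smaller : ∀ {x} → x <ᶠ suc (suc v) → τ ⟨$⟩ʳ (τ ⟨$⟩ˡ x) <ᶠ τ ⟨$⟩ʳ fromℕ n
  smaller = subst₂ _<ᶠ_ (sym (inverseʳ τ)) (sym eq)

  before : ∀ {x} → x <ᶠ suc (suc v) → τ ⟨$⟩ˡ x <ᶠ fromℕ n
  before {x} x< = ≤∧≢⇒< (≤fromℕ _) λ pos≡last →
    <-irrefl (trans (sym (inverseʳ τ)) (trans (cong (τ ⟨$⟩ʳ_) pos≡last) eq)) x<

-- The invariant of the induction. A missing value must come after the whole prefix, so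
-- `sparseMissing` is what sparseness of an extension demands at that value.
record Extensible (c : Vector (Fin n) t) : Set where
  field
    injective     : Injective _≡_ _≡_ c
    sparse        : Sparse c
    sparseMissing : ∀ {α} → (∀ i → α ≢ c i) → ∀ {i j} → c i <ᶠ α → c j <ᶠ α → i ≡ j

open Extensible

-- A value `α` missing from `c′` becomes `punchIn d α`, missing from `c`, with order preserved.
Extensible-punchIn : ∀ d {c : Vector (Fin (suc n)) t} {c′} →
                     (∀ i → c i ≡ punchIn d (c′ i)) → Extensible c → Extensible c′
Extensible-punchIn d {c} {c′} c≡ ext = record
  { injective     = λ {i} {j} eq →
      injective ext (trans (c≡ i) (trans (cong (punchIn d) eq) (sym (c≡ j))))
  ; sparse        = Sparse-punchIn d c≡ (sparse ext)
  ; sparseMissing = λ {α} α∉c′ c′i<α c′j<α →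
      sparseMissing ext {punchIn d α}
        (λ i eq → α∉c′ i (punchIn-injective d _ _ (trans eq (c≡ i))))
        (lift c′i<α) (lift c′j<α)
  }
  where
  lift : ∀ {i α} → c′ i <ᶠ α → c i <ᶠ punchIn d α
  lift {i} lt = subst (_<ᶠ _) (sym (c≡ i)) (punchIn-mono-< d lt)

-- Counting extensions by removing last entries.

toPermutation : (f : Fin n → Fin n) → Injective _≡_ _≡_ f → Permutation′ n
toPermutation f inj = permutation f (proj₁ ∘ f⁻¹) (proj₂ ∘ f⁻¹) (λ x → inj (proj₂ (f⁻¹ (f x))))
  where f⁻¹ = injective⇒surjective f inj

complete-cardinality : .(n≤n : n ≤ n) (c : Vector (Fin n) n) → Injective _≡_ _≡_ c → Sparse c →
                       HasCardinality (Permutations (Extends n≤n c)) 1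
complete-cardinality n≤n c inj sp = record
  { to        = λ _ → zero
  ; from      = λ _ → toPermutation c inj , (λ i → cong c (inject≤-refl i n≤n)) , sp
  ; to-cong   = λ _ → refl
  ; from-cong = λ _ _ → refl
  ; inverse   = (λ { {zero} _ → refl })
              , λ { {τ , prefix , _} _ i → sym
                  (trans (cong (τ ⟨$⟩ʳ_) (sym (inject≤-refl i n≤n))) (prefix i)) }
  }

-- Skipping 1 and skipping 0 agree away from 0, so a prefix missing both values reduces to the same
-- prefix either way.
punchIn-1 : (x : Fin (suc n)) → x ≢ zero → punchIn (suc zero) x ≡ suc x
punchIn-1 zero    x≢0 = contradiction refl x≢0
punchIn-1 (suc x) _   = refl

module _ (t≤n : t ≤ suc n) .(t≤2+n : t ≤ suc (suc n)) {c : Vector (Fin (suc (suc n))) t} where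

  forced : ∀ d → toℕ d ≤ 1 → (d∉c : ∀ i → d ≢ c i) →
           (∀ τ → Extends t≤2+n c τ → τ ⟨$⟩ʳ fromℕ _ ≡ d) →
           HasCardinality (Permutations (Extends t≤n λ i → punchOut (d∉c i))) m →
           HasCardinality (Permutations (Extends t≤2+n c)) m
  forced {m} d d≤1 d∉c last≡d h =
    subst (HasCardinality _) (*-identityˡ m)
      (decomposeLast-cardinality {k = 1} (λ _ → d) (λ { {zero} {zero} _ → refl })
        (λ {τ} {ρ} → Extends-resp t≤2+n c {τ} {ρ}) (λ τ p → zero , last≡d τ p)
        (λ _ → Extends-append t≤2+n t≤n d d≤1 (λ i → sym (punchIn-punchOut (d∉c i)))) h)

  free : (0∉c : ∀ i → zero ≢ c i) → (∀ i → suc zero ≢ c i) →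
         HasCardinality (Permutations (Extends t≤n λ i → punchOut (0∉c i))) m →
         HasCardinality (Permutations (Extends t≤2+n c)) (2 * m)
  free 0∉c 1∉c = decomposeLast-cardinality {k = 2} (_↑ˡ _) (↑ˡ-injective _ _ _)
      (λ {τ} {ρ} → Extends-resp t≤2+n c {τ} {ρ})
      (λ τ (_ , sp) → small (last≤1 τ sp))
      λ { zero       → Extends-append t≤2+n t≤n zero z≤n c≡
        ; (suc zero) → Extends-append t≤2+n t≤n (suc zero) (s≤s z≤n)
            -- A reduced entry 0 would come from an entry 1 of `c`.
            λ i → trans (c≡ i) (sym (punchIn-1 _ λ eq → 1∉c i (sym (trans (c≡ i) (cong suc eq))))) }
    where
    c≡ : ∀ i → c i ≡ punchIn zero (punchOut (0∉c i))
    c≡ i = sym (punchIn-punchOut (0∉c i))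

    small : ∀ {y : Fin (suc (suc n))} → toℕ y ≤ 1 → ∃[ x ] y ≡ x ↑ˡ n
    small {zero}       _ = zero , refl
    small {suc zero}   _ = suc zero , refl
    small {suc (suc _)} (s≤s ())

-- Induction on `t ≤′ n` lowers `n` with `t` fixed. Closing gaps preserves order, so `μ` remains a
-- position of the minimum. Values in `Fin n` start at 0, hence `∸ 1` where the integers have minus
-- 2.
cardinality : (t≤′n : t ≤′ n) (c : Vector (Fin n) t) → Extensible c →
              ∀ μ → (∀ i → c μ ≤ᶠ c i) →
              HasCardinality (Permutations (Extends (≤′⇒≤ t≤′n) c)) (2 ^ (toℕ (c μ) ∸ 1))
cardinality {n = suc n} (≤′-reflexive refl) c ext μ c-min =
  subst (λ v → HasCardinality _ (2 ^ (v ∸ 1))) (sym cμ≡0)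
    (complete-cardinality ≤-refl c (injective ext) (sparse ext))
  where
  -- A prefix of full length contains every value, in particular 0.
  cμ≡0 : toℕ (c μ) ≡ 0
  cμ≡0 = let i , ci≡0 = injective⇒surjective c (injective ext) zero
         in n≤0⇒n≡0 (subst (c μ ≤ᶠ_) ci≡0 (c-min i))
-- Here `t` would be 0, yet `μ` is a position in `c`.
cardinality (≤′-step {n = 0} t≤′n) c ext μ c-min =
  contradiction (inject≤ μ (≤′⇒≤ t≤′n)) ¬Fin0
cardinality {t = t} (≤′-step {n = suc n} t≤′n) c ext μ c-min = step (c μ) refl
  where
  t≤n : t ≤ suc n
  t≤n = ≤′⇒≤ t≤′n

  t≤2+n : t ≤ suc (suc n)
  t≤2+n = ≤′⇒≤ (≤′-step t≤′n)

  recurse : ∀ d (d∉c : ∀ i → d ≢ c i) {v} → c μ ≡ punchIn d v →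
            HasCardinality (Permutations (Extends t≤n λ i → punchOut (d∉c i))) (2 ^ (toℕ v ∸ 1))
  recurse d d∉c {v} cμ≡ =
    subst (λ v → HasCardinality _ (2 ^ (toℕ v ∸ 1)))
      (punchIn-injective d _ _ (trans (punchIn-punchOut (d∉c μ)) cμ≡))
      (cardinality t≤′n _ (Extensible-punchIn d (λ i → sym (punchIn-punchOut (d∉c i))) ext) μ
        λ i → punchIn-cancel-≤ d _ _
          (subst₂ _≤ᶠ_ (sym (punchIn-punchOut (d∉c μ))) (sym (punchIn-punchOut (d∉c i))) (c-min i)))

  last≡0⊎1 : ∀ τ → Extends t≤2+n c τ →
             τ ⟨$⟩ʳ fromℕ (suc n) ≡ zero ⊎ τ ⟨$⟩ʳ fromℕ (suc n) ≡ suc zero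
  last≡0⊎1 τ (_ , sp) with τ ⟨$⟩ʳ fromℕ (suc n) | last≤1 τ sp
  ... | zero        | _      = inj₁ refl
  ... | suc zero    | _      = inj₂ refl
  ... | suc (suc _) | s≤s ()

  below∉c : ∀ {x} → x <ᶠ c μ → ∀ i → x ≢ c i
  below∉c x<cμ i refl = <⇒≱ x<cμ (c-min i)

  step : ∀ m → c μ ≡ m → HasCardinality (Permutations (Extends t≤2+n c)) (2 ^ (toℕ m ∸ 1))
  -- The value 0 is used by `c`, so the last entry is 1; the minimum stays 0.
  step zero cμ≡0 = forced t≤n t≤2+n (suc zero) (s≤s z≤n) 1∉c last≡1 (recurse (suc zero) 1∉c cμ≡0)
    where
    α : Fin (suc (suc n))
    α = proj₁ (missing (s≤s t≤n) c)

    α∉c : ∀ i → α ≢ c i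
    α∉c = proj₂ (missing (s≤s t≤n) c)

    above : ∀ α → α ≢ zero → α ≢ suc zero → suc {suc n} zero <ᶠ α
    above zero          α≢0 _   = contradiction refl α≢0
    above (suc zero)    _   α≢1 = contradiction refl α≢1
    above (suc (suc _)) _   _   = s≤s (s≤s z≤n)

    -- If 0 and 1 were both in `c`, the missing `α` would exceed both, and `sparseMissing` would
    -- equate their positions.
    1∉c : ∀ i → suc zero ≢ c i
    1∉c i 1≡ci = contradiction (trans 1≡ci (trans (cong c (sym μ≡i)) cμ≡0)) λ ()
      where
      1<α : suc {suc n} zero <ᶠ α
      1<α = above α (λ eq → α∉c μ (trans eq (sym cμ≡0))) (λ eq → α∉c i (trans eq 1≡ci))
      μ≡i : μ ≡ i
      μ≡i = sparseMissing ext α∉c (subst (_<ᶠ α) (sym cμ≡0) (<⇒≤ 1<α)) (subst (_<ᶠ α) 1≡ci 1<α)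

    last≡1 : ∀ τ → Extends t≤2+n c τ → τ ⟨$⟩ʳ fromℕ (suc n) ≡ suc zero
    last≡1 τ p with last≡0⊎1 τ p
    ... | inj₁ last≡0 = contradiction (trans last≡0 (sym cμ≡0)) (last∉prefix t≤2+n t≤n c {τ} p μ)
    ... | inj₂ last≡1 = last≡1
  -- The minimum drops from 1 to 0, but truncated subtraction keeps the exponent at 0.
  step (suc zero) cμ≡1 = forced t≤n t≤2+n zero z≤n 0∉c last≡0 (recurse zero 0∉c {zero} cμ≡1)
    where
    0∉c : ∀ i → zero ≢ c i
    0∉c = below∉c (subst (zero {suc n} <ᶠ_) (sym cμ≡1) (s≤s z≤n))

    last≡0 : ∀ τ → Extends t≤2+n c τ → τ ⟨$⟩ʳ fromℕ (suc n) ≡ zero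
    last≡0 τ p with last≡0⊎1 τ p
    ... | inj₁ last≡0 = last≡0
    ... | inj₂ last≡1 = contradiction (trans last≡1 (sym cμ≡1)) (last∉prefix t≤2+n t≤n c {τ} p μ)
  -- The exponent drops by one, balanced by the factor 2.
  step (suc (suc v)) cμ≡ = free t≤n t≤2+n 0∉c 1∉c (recurse zero 0∉c {suc v} cμ≡)
    where
    0∉c : ∀ i → zero ≢ c i
    0∉c = below∉c (subst (zero {suc n} <ᶠ_) (sym cμ≡) (s≤s z≤n))

    1∉c : ∀ i → suc zero ≢ c i
    1∉c = below∉c (subst (suc {suc n} zero <ᶠ_) (sym cμ≡) (s≤s (s≤s z≤n)))

-- The minimum of the prefix.

minEntry-≤ : (c : Vector (Fin n) t) → ∀ i → minEntry c ≤ suc (toℕ (c i))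
minEntry-≤ {n} c = tabulate⁻ (Extrema.min≤xs n (tabulate λ i → suc (toℕ (c i))))

minEntry-attained : (c : Vector (Fin n) t) → Fin t → ∃[ μ ] minEntry c ≡ suc (toℕ (c μ))
minEntry-attained {n} c i with Extrema.argmin-sel id n (tabulate λ i → suc (toℕ (c i)))
-- If the default `n` is the minimum, every entry is squeezed to the largest value, so the given
-- position attains it.
... | inj₁ min≡n = i ,
  ≤-antisym (minEntry-≤ c i) (subst (suc (toℕ (c i)) ≤_) (sym min≡n) (toℕ<n (c i)))
... | inj₂ min∈c = ∈-tabulate⁻ min∈c

-- Return to pattern avoidance.

module _ .(t≤n : t ≤ n) (c : Vector (Fin n) t) where

  S⇔Extends : ∀ τ → IsIn-S t≤n c ((3 , π123) ∷ (3 , π213) ∷ []) τ ⇔ Extends t≤n c τ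
  S⇔Extends τ = mk⇔
    (λ { (prefix , av₁ ∷ av₂ ∷ []) → prefix , avoids⇒Sparse (⟨$⟩ʳ-injective τ) av₁ av₂ })
    λ (prefix , sp) → prefix ,
      Sparse⇒avoids {τ = τ ⟨$⟩ʳ_} sp π123 (s≤s z≤n) (s≤s (s≤s z≤n)) ∷
      Sparse⇒avoids {τ = τ ⟨$⟩ʳ_} sp π213 (s≤s (s≤s z≤n)) (s≤s z≤n) ∷ []

  -- The missing `α` must occur after the prefix, preceded by two smaller entries, against
  -- sparseness.
  Extends⇒¬TwoEntriesBelowMissing : ∀ {τ} → Extends t≤n c τ → ¬ TwoEntriesBelowMissing c
  Extends⇒¬TwoEntriesBelowMissing {τ} (prefix , sp) (α , α∉c , i , j , i<j , ci<α , cj<α) =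
    <-irrefl (inject≤-injective t≤n t≤n i j
      (sp (before i) (before j) (smaller ci<α) (smaller cj<α))) i<j
    where
    pos : Fin n
    pos = τ ⟨$⟩ˡ α

    smaller : ∀ {i} → c i <ᶠ α → τ ⟨$⟩ʳ inject≤ i t≤n <ᶠ τ ⟨$⟩ʳ pos
    smaller = subst₂ _<ᶠ_ (sym (prefix _)) (sym (inverseʳ τ))

    beyond : t ≤ toℕ pos
    beyond = ≮⇒≥ λ pos<t → α∉c (fromℕ< pos<t)
      (trans (sym (inverseʳ τ)) (trans (cong (τ ⟨$⟩ʳ_) (toℕ-injective
        (sym (trans (toℕ-inject≤ _ t≤n) (toℕ-fromℕ< pos<t))))) (prefix _)))

    before : ∀ i → inject≤ i t≤n <ᶠ pos
    before i = subst (_< toℕ pos) (sym (toℕ-inject≤ i t≤n)) (≤-trans (toℕ<n i) beyond)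

empty-cardinality : {P : Permutation′ n → Set} → (∀ τ → ¬ P τ) → HasCardinality (Permutations P) 0
empty-cardinality ¬P = record
  { to        = λ (τ , p) → contradiction p (¬P τ)
  ; from      = λ ()
  ; to-cong   = λ { {τ , p} _ → contradiction p (¬P τ) }
  ; from-cong = λ { {()} }
  ; inverse   = (λ { {()} }) , λ { {τ , p} _ → contradiction p (¬P τ) }
  }

theorem5p5 : (n t : ℕ) → 3 ≤ n → 1 ≤ t → (t<n : t < n) →
    (c : Vector (Fin n) t) → Injective _≡_ _≡_ c →
    Avoids c π123 → Avoids c π213 →
    (TwoEntriesBelowMissing c →
    HasCardinality (S (<⇒≤ t<n) c ((3 , π123) ∷ (3 , π213) ∷ [])) 0) ×
    (¬ TwoEntriesBelowMissing c →
    HasCardinality (S (<⇒≤ t<n) c ((3 , π123) ∷ (3 , π213) ∷ []))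
    (2 ^ (0 ⊔ (minEntry c ∸ 2))))
theorem5p5 n (suc t) _ _ t<n c c-injective avoids-123 avoids-213 = empty , nonempty
  where
  t≤n : suc t ≤ n
  t≤n = <⇒≤ t<n

  empty : TwoEntriesBelowMissing c → HasCardinality (S t≤n c _) 0
  empty two = empty-cardinality λ τ p →
    Extends⇒¬TwoEntriesBelowMissing t≤n c {τ} (Equivalence.to (S⇔Extends t≤n c τ) p) two

  extensible : ¬ TwoEntriesBelowMissing c → Extensible c
  extensible ¬two = record
    { injective     = c-injective
    ; sparse        = avoids⇒Sparse c-injective avoids-123 avoids-213
    ; sparseMissing = sparseMissing′
    }
    where
    sparseMissing′ : ∀ {α} → (∀ i → α ≢ c i) → ∀ {i j} → c i <ᶠ α → c j <ᶠ α → i ≡ j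
    sparseMissing′ {α} α∉c {i} {j} ci<α cj<α with <-cmp i j
    ... | tri< i<j _ _ = contradiction (α , α∉c , i , j , i<j , ci<α , cj<α) ¬two
    ... | tri≈ _ i≡j _ = i≡j
    ... | tri> _ _ j<i = contradiction (α , α∉c , j , i , j<i , cj<α , ci<α) ¬two

  nonempty : ¬ TwoEntriesBelowMissing c → HasCardinality (S t≤n c _) (2 ^ (0 ⊔ (minEntry c ∸ 2)))
  nonempty ¬two with minEntry-attained c zero
  ... | μ , min≡ = inverse (Permutations-cong (S⇔Extends t≤n c))
    -- By computation `0 ⊔ x` is `x`, and `suc x ∸ 2` is `x ∸ 1`, the exponent in `cardinality`.
    (subst (λ v → HasCardinality (Permutations (Extends t≤n c)) (2 ^ (v ∸ 2))) (sym min≡)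
      (cardinality (≤⇒≤′ t≤n) c (extensible ¬two) μ
        λ i → s≤s⁻¹ (subst (_≤ _) min≡ (minEntry-≤ c i))))
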